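{- For every $k\in\mathbb N$ there exist a constant $c>0$ and simple graphs $\mathcal G$ with arbitrarily large numbers of edges $m$ such that every f-representation of $\operatorname{Hom}(\mathcal K_k,\mathcal G)$ has size at least $c\, m^{k/2}/\log^{k}(m)$, i.e. size $\Omega(m^{k/2}/\log^k(m))$.
   Context: $\mathcal K_k$ is the complete graph on $k$ vertices; graphs are viewed as structures with a symmetric binary edge relation, and $\operatorname{Hom}(\mathcal K_k,\mathcal G)$ is the set of graph homomorphisms (edge-preserving maps). A factorisation circuit $C$ for finite sets $A,B$ is a finite directed acyclic graph with a unique sink $s$; each node with no incoming edges (input gate) is labelled by $\{a\mapsto b\}$ with $a\in A,b\in B$; every other node is labelled $\cup$ or $\times$. The domain $\operatorname{dom}(g)$ is $\{a\}$ for an input gate labelled $\{a\mapsto b\}$, and the union of the children's domains otherwise. $C$ is well-defined if every $\cup$-gate has the same domain as each of its children and the children of every $\times$-gate have pairwise disjoint domains. For well-defined $C$, each gate $g$ gets a set $S_g$ of maps $\operatorname{dom}(g)\to B$: $S_g=\{\{a\mapsto b\}\}$ for an input gate, $S_g=S_{g_1}\cup\dots\cup S_{g_r}$ for a $\cup$-gate with children $g_1,\dots,g_r$, and $S_g=\{h_1\cup\dots\cup h_r: h_i\in S_{g_i}\}$ for a $\times$-gate; $S_C:=S_s$. $C$ is treelike if every non-sink gate has exactly one parent. The size $\|C\|$ is the number of gates plus the number of wires. A d-representation of $\operatorname{Hom}(\mathcal A,\mathcal B)$ is a well-defined factorisation circuit for the universes with $S_C=\operatorname{Hom}(\mathcal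 A,\mathcal B)$; an f-representation is a treelike d-representation. -}

module Defs where

open import Level using (0ℓ)
open import Data.Nat using (ℕ; _+_; _*_; _^_; _≤_; NonZero)
open import Data.Integer using (∣_∣)
open import Data.Rational using (ℚ; ↥_; ↧ₙ_)
open import Data.Fin using (Fin; _<?_)
open import Data.Fin.Properties using (_≟_)
open import Data.List using (List; length; filter; allFin; cartesianProduct)
open import Data.Maybe using (Maybe; just)
open import Data.Product using (_×_; _,_; uncurry; ∃; ∃₂; ∃-syntax; ∃!)
open import Function using (_∘_; _⇔_)
open import Relation.Nullary using (¬_; ¬?; _×-dec_)
open import Relation.Unary using (Pred; _∈_; _≐_; _⊥_)
open import Relation.Binary using (Rel; Symmetric; Irreflexive; Decidable; _Preserves_⟶_)
open import Relation.Binary.Construct.Closure.Transitive using (TransClosure)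
open import Relation.Binary.PropositionalEquality using (_≡_; _≢_; _≗_; ≢-sym)

pairs : (n : ℕ) → List (Fin n × Fin n)
pairs n = cartesianProduct (allFin n) (allFin n)

record SimpleGraph : Set₁ where
  field
    order  : ℕ
    Edge   : Rel (Fin order) 0ℓ
    edge?  : Decidable Edge
    sym    : Symmetric Edge
    irrefl : Irreflexive _≡_ Edge

  Vertex : Set
  Vertex = Fin order

  -- Each undirected edge {u, v} is counted once, as the pair with u < v.
  edgeCount : ℕ
  edgeCount = length (filter (λ (u , v) → (u <? v) ×-dec edge? u v) (pairs order))

open SimpleGraph using (Vertex; edgeCount) public

𝒦 : ℕ → SimpleGraph
𝒦 k = record
  { order  = k
  ; Edge   = _≢_
  ; edge?  = λ u v → ¬? (u ≟ v)
  ; sym    = ≢-sym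
  ; irrefl = λ u≡v u≢v → u≢v u≡v
  }

Hom : (𝒜 ℬ : SimpleGraph) → Pred (Vertex 𝒜 → Vertex ℬ) 0ℓ
Hom 𝒜 ℬ h = h Preserves SimpleGraph.Edge 𝒜 ⟶ SimpleGraph.Edge ℬ

data Label (A B : Set) : Set where
  _↦_     : A → B → Label A B
  ∪-gate  : Label A B
  ×-gate  : Label A B

-- Maps from a subset of A to B; a is in the domain of f iff f a is a just.
_⇀_ : Set → Set → Set
A ⇀ B = A → Maybe B

record Circuit (A B : Set) : Set₁ where
  field
    gates : ℕ

  Gate : Set
  Gate = Fin gates

  field
    -- Wire g′ g is a wire from g′ to g: g′ is a child of g, g a parent of g′.
    Wire    : Rel Gate 0ℓ
    wire?   : Decidable Wire
    acyclic : ∀ g → ¬ TransClosure Wire g g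

  Sink : Pred Gate 0ℓ
  Sink g = ∀ p → ¬ Wire g p

  field
    sink        : Gate
    sink-isSink : Sink sink
    sink-unique : ∀ g → Sink g → g ≡ sink
    label       : Gate → Label A B
    input-label : ∀ g → (∀ g′ → ¬ Wire g′ g) ⇔ (∃₂ λ a b → label g ≡ a ↦ b)

  -- As Wire is acyclic on a finite set, the inductive families dom and S below
  -- are the unique solutions of the recursive equations defining dom(g) and S_g.
  data dom (g : Gate) : Pred A 0ℓ where
    input : ∀ {a b} → label g ≡ a ↦ b → a ∈ dom g
    child : ∀ {g′ a} → Wire g′ g → a ∈ dom g′ → a ∈ dom g

  record WellDefined : Set where
    field
      ∪-dom : ∀ {g g′} → label g ≡ ∪-gate → Wire g′ g → dom g ≐ dom g′
      ×-dom : ∀ {g g₁ g₂} → label g ≡ ×-gate → Wire g₁ g → Wire g₂ g → g₁ ≢ g₂ → dom g₁ ⊥ dom g₂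

  -- Partial maps are described through their graphs {(x , y) | f x ≡ just y}, so
  -- S g is closed under pointwise equality.  In the ×-case only the values of h
  -- at the children of g matter.
  data S (g : Gate) : Pred (A ⇀ B) 0ℓ where
    input : ∀ {f a b} → label g ≡ a ↦ b →
            (∀ x y → f x ≡ just y ⇔ (x ≡ a × y ≡ b)) →
            f ∈ S g
    union : ∀ {f g′} → label g ≡ ∪-gate → Wire g′ g → f ∈ S g′ → f ∈ S g
    times : ∀ {f} → label g ≡ ×-gate →
            (h : Gate → A ⇀ B) →
            (∀ {g′} → Wire g′ g → h g′ ∈ S g′) →
            (∀ x y → f x ≡ just y ⇔ (∃[ g′ ] Wire g′ g × h g′ x ≡ just y)) →
            f ∈ S g

  Treelike : Set
  Treelike = ∀ g → g ≢ sink → ∃! _≡_ (λ p → Wire g p)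

  wireCount : ℕ
  wireCount = length (filter (uncurry wire?) (pairs gates))

  size : ℕ
  size = gates + wireCount

open Circuit using (size) public

record IsDRepresentation (𝒜 ℬ : SimpleGraph) (C : Circuit (Vertex 𝒜) (Vertex ℬ)) : Set where
  open Circuit C
  field
    wellDefined : WellDefined
    represents  : S sink ≐ (λ f → ∃[ h ] h ∈ Hom 𝒜 ℬ × f ≗ just ∘ h)

record IsFRepresentation (𝒜 ℬ : SimpleGraph) (C : Circuit (Vertex 𝒜) (Vertex ℬ)) : Set where
  field
    isDRepresentation : IsDRepresentation 𝒜 ℬ C
    treelike          : Circuit.Treelike C

-- s ≥ c · m^(k/2) / (log₂ m)^k for c > 0 and m ≥ 2.  The inequality is squared,
-- s² · (log₂ m)^(2k) ≥ c² · m^k, and log₂ m is the infimum of the rationals p/q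
-- with log₂ m ≤ p/q, that is m^q ≤ 2^p; denominators are cleared.
AtLeast : (s : ℕ) (c : ℚ) (m k : ℕ) → Set
AtLeast s c m k = ∀ (p q : ℕ) .{{_ : NonZero q}} → m ^ q ≤ 2 ^ p →
  (∣ ↥ c ∣ ^ 2 * m ^ k) * q ^ (2 * k) ≤ ((↧ₙ c) ^ 2 * s ^ 2) * p ^ (2 * k)

{-# OPTIONS --safe #-}
-- Colour [n] × [n], n = 2 ^ r, with two colours so that no rectangle with sides of
-- length t = 2 r + 2 is monochromatic; a union bound shows that this is possible.
-- Each k-tuple x has a profile, the colours of the pairs (xᵢ , xⱼ); let s be the
-- profile of at least n ^ k / 2 ^ k² tuples.  In the k-partite graph on [k] × [n] in
-- which (i , x) and (j , y), i < j, are adjacent iff (x , y) has colour s i j, these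
-- tuples are k-cliques, while there is no biclique with two sides larger than
-- T = O(k log n).
--
-- In a circuit for the k-cliques of such a graph, the values that two distinct
-- children of a ×-gate can take form bicliques.  Hence all children of a ×-gate but
-- at most one are small: they take at most T values at each argument.  Follow a
-- clique from the sink down to an input gate v, always choosing the large child of a
-- ×-gate.  In a treelike circuit v determines the path, and then every value of the
-- clique is one of at most T values.  So there are at most T ^ k cliques per gate.
module Submission where

open import Defs
open import Data.Nat as ℕ using (ℕ; zero; suc; z≤n; s≤s; _≤_; _≤?_; _+_; _*_; _^_; NonZero)
open import Data.Nat.Properties
open import Data.Rational using (ℚ; 0ℚ; _<_; mkℚ; *<*)
open import Data.Product using (Σ; ∃; _×_; _,_; proj₁; proj₂)
open import Relation.Unary using (Satisfiable)

import Algebra.Properties.CommutativeSemigroup +-commutativeSemigroup as +-CS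
import Algebra.Properties.CommutativeSemigroup *-commutativeSemigroup as *-CS
open import Data.Bool using (Bool; true; false)
import Data.Bool.Properties as Bool
open import Data.Empty using (⊥; ⊥-elim)
open import Data.Fin as Fin using (Fin; remQuot; combine; funToFin; finToFun)
open import Data.Fin.Induction using (spo-wellFounded; spo-noetherian)
import Data.Fin.Properties as Fin
open import Data.Fin.Subset as Subset using (Subset; inside; outside; ∣_∣; ⁅_⁆; _∪_)
open import Data.Fin.Subset.Properties using (p⊂q⇒∣p∣<∣q∣; q⊆p∪q; p⊆p∪q; x∈p∪q⁻; x∈⁅y⁆⇒x≡y; x∈⁅x⁆; ∉⊥; out⊆; in⊆in)
open import Data.Integer using (1ℤ; +<+)
open import Data.List using (List; []; _∷_; _++_; length; map; filter; concatMap; allFin; cartesianProductWith)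
import Data.List.Extrema ≤-totalOrder as Extrema
import Data.List.Membership.DecPropositional as DecMembership
open import Data.List.Membership.Propositional using (_∈_)
open import Data.List.Membership.Propositional.Properties
open import Data.List.Properties using (length-++; length-map; length-tabulate; length-filter; map-++)
open import Data.List.Relation.Binary.Subset.Propositional using (_⊆_)
open import Data.List.Relation.Unary.All as All using ([])
open import Data.List.Relation.Unary.Any as Any using (here; there)
open import Data.List.Relation.Unary.Unique.Propositional using (Unique; []; _∷_)
import Data.List.Relation.Unary.Unique.Propositional.Properties as Unique
open import Data.Maybe using (Maybe; just; nothing)
open import Data.Maybe.Properties using (just-injective)
open import Data.Nat.Coprimality using (1-coprimeTo)
open import Data.Nat.ListAction using (sum)
open import Data.Nat.ListAction.Properties using (sum-++)
open import Data.Nat.Solver using (module +-*-Solver)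
open import Data.Sum using (_⊎_; inj₁; inj₂; swap)
open import Data.Unit using (⊤; tt)
open import Data.Vec as Vec using (Vec; []; _∷_; lookup)
import Data.Vec.Properties as Vec
open import Data.Vec.Relation.Binary.Pointwise.Inductive as Pointwise using (Pointwise; []; _∷_)
open import Function using (_∘_; id; flip; mk⇔; Equivalence; Inverse)
open import Induction.WellFounded using (WellFounded; Acc; acc; module Subrelation)
open import Relation.Binary using (IsStrictPartialOrder; tri<; tri≈; tri>)
open import Relation.Binary.Construct.Closure.ReflexiveTransitive using (Star; ε; _◅_; _◅◅_)
open import Relation.Binary.Construct.Closure.Transitive using (TransClosure; [_]; transitive)
open import Relation.Binary.PropositionalEquality
open import Relation.Nullary using (¬_; Dec; yes; no; contradiction; ¬?; _×-dec_; _⊎-dec_)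
open import Relation.Nullary.Decidable using (map′)
import Relation.Unary as Unary
open SimpleGraph using (Edge)
open +-*-Solver using (solve; _:=_; _:+_; _:*_; con)

-- Counting with duplicate-free lists, fibres and tuples.

module _ {A : Set} where

  Unique-⊆⇒length≤ : {xs ys : List A} → Unique xs → xs ⊆ ys → length xs ≤ length ys
  Unique-⊆⇒length≤ {[]} _ _ = z≤n
  Unique-⊆⇒length≤ {x ∷ xs} {ys} u@(_ ∷ uxs) xs⊆ys with ∈-∃++ (xs⊆ys (here refl))
  ... | as , bs , refl = begin
    suc (length xs)             ≤⟨ s≤s (Unique-⊆⇒length≤ uxs xs⊆as++bs) ⟩
    suc (length (as ++ bs))     ≡⟨ cong suc (length-++ as) ⟩
    suc (length as + length bs) ≡⟨ sym (+-suc (length as) (length bs)) ⟩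
    length as + suc (length bs) ≡⟨ sym (length-++ as) ⟩
    length (as ++ x ∷ bs)       ∎
    where
    open ≤-Reasoning
    xs⊆as++bs : xs ⊆ as ++ bs
    xs⊆as++bs {y} y∈xs with ∈-++⁻ as (xs⊆ys (there y∈xs))
    ... | inj₁ y∈as         = ∈-++⁺ˡ y∈as
    ... | inj₂ (here refl)  = contradiction y∈xs (Unique.Unique[x∷xs]⇒x∉xs u)
    ... | inj₂ (there y∈bs) = ∈-++⁺ʳ as y∈bs

  module _ {B : Set} where

    length-concatMap-≤ : (f : A → List B) {L : ℕ} → (∀ x → length (f x) ≤ L) →
                         ∀ xs → length (concatMap f xs) ≤ length xs * L
    length-concatMap-≤ f f≤L []       = z≤n
    length-concatMap-≤ f f≤L (x ∷ xs) = begin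
      length (f x ++ concatMap f xs)         ≡⟨ length-++ (f x) ⟩
      length (f x) + length (concatMap f xs) ≤⟨ +-mono-≤ (f≤L x) (length-concatMap-≤ f f≤L xs) ⟩
      length (x ∷ xs) * _                    ∎
      where open ≤-Reasoning

    module _ {C : Set} (f : A → B → C) where

      length-cartesianProductWith : ∀ xs ys →
        length (cartesianProductWith f xs ys) ≡ length xs * length ys
      length-cartesianProductWith []       ys = refl
      length-cartesianProductWith (x ∷ xs) ys = trans (length-++ (map (f x) ys))
        (cong₂ _+_ (length-map (f x) ys) (length-cartesianProductWith xs ys))

module _ {A : Set} where

  fibre : ∀ {N} → (A → Fin N) → List A → Fin N → List A
  fibre f xs s = filter (λ x → f x Fin.≟ s) xs

  ∈-fibre⁻ : ∀ {N} (f : A → Fin N) xs {s x} → x ∈ fibre f xs s → x ∈ xs × f x ≡ s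
  ∈-fibre⁻ f xs {s} = ∈-filter⁻ (λ x → f x Fin.≟ s)

  Unique-fibre : ∀ {N} (f : A → Fin N) {xs} s → Unique xs → Unique (fibre f xs s)
  Unique-fibre f s = Unique.filter⁺ (λ x → f x Fin.≟ s)

  -- Pigeonhole: the fibres together cover `xs`, and none is longer than the one at the maximiser
  -- `s`.
  largest-fibre : ∀ {N} .{{_ : NonZero N}} (f : A → Fin N) {xs} → Unique xs →
                  ∃ λ s → length xs ≤ N * length (fibre f xs s)
  largest-fibre {suc N} f {xs} uxs = s , (begin
    length xs                                         ≤⟨ Unique-⊆⇒length≤ uxs xs⊆fibres ⟩
    length (concatMap (fibre f xs) (allFin (suc N)))  ≤⟨ length-concatMap-≤ (fibre f xs) fibre≤ (allFin (suc N)) ⟩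
    length (allFin (suc N)) * length (fibre f xs s)   ≡⟨ cong (_* length (fibre f xs s)) (length-tabulate {n = suc N} id) ⟩
    suc N * length (fibre f xs s)                     ∎)
    where
    open ≤-Reasoning
    card = λ s → length (fibre f xs s)
    s = Extrema.argmax card Fin.zero (allFin (suc N))
    fibre≤ : ∀ s′ → card s′ ≤ card s
    fibre≤ s′ = All.lookup (Extrema.f[xs]≤f[argmax] {f = card} Fin.zero (allFin (suc N))) (∈-allFin s′)
    xs⊆fibres : xs ⊆ concatMap (fibre f xs) (allFin (suc N))
    xs⊆fibres {x} x∈xs = ∈-concatMap⁺ (fibre f xs)
      (Any.map (λ { refl → ∈-filter⁺ _ x∈xs refl }) (∈-allFin (f x)))

-- Tuples are vectors rather than functions, so that distinctness can be stated with propositional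
-- equality without function extensionality.
tuples : ∀ {A : Set} {k} → (Fin k → List A) → List (Vec A k)
tuples {k = zero}  c = [] ∷ []
tuples {k = suc k} c = cartesianProductWith _∷_ (c Fin.zero) (tuples (c ∘ Fin.suc))

module _ {A : Set} where

  length-tuples-≤ : ∀ {k} (c : Fin k → List A) {L} → (∀ i → length (c i) ≤ L) →
                    length (tuples c) ≤ L ^ k
  length-tuples-≤ {zero}  c c≤L = ≤-refl
  length-tuples-≤ {suc k} c c≤L = ≤-trans
    (≤-reflexive (length-cartesianProductWith _∷_ (c Fin.zero) _))
    (*-mono-≤ (c≤L Fin.zero) (length-tuples-≤ (c ∘ Fin.suc) (c≤L ∘ Fin.suc)))

  length-tuples : ∀ k (xs : List A) → length (tuples {k = k} (λ _ → xs)) ≡ length xs ^ k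
  length-tuples zero    xs = refl
  length-tuples (suc k) xs = trans (length-cartesianProductWith _∷_ xs _)
    (cong (length xs *_) (length-tuples k xs))

  ∈-tuples⁺ : ∀ {k} {c : Fin k → List A} {v} → (∀ i → lookup v i ∈ c i) → v ∈ tuples c
  ∈-tuples⁺ {v = []}    v∈c = here refl
  ∈-tuples⁺ {v = x ∷ v} v∈c = ∈-cartesianProductWith⁺ _∷_ (v∈c Fin.zero) (∈-tuples⁺ (v∈c ∘ Fin.suc))

  Unique-tuples : ∀ {k} {c : Fin k → List A} → (∀ i → Unique (c i)) → Unique (tuples c)
  Unique-tuples {zero}  uc = [] ∷ []
  Unique-tuples {suc k} uc =
    Unique.cartesianProductWith⁺ _∷_ Vec.∷-injective (uc Fin.zero) (Unique-tuples (uc ∘ Fin.suc))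

-- Colourings without monochromatic rectangles

-- A partial assignment of bits, with `nothing` at the free positions. It stands for the bad event
-- that a full assignment agrees with it.
Pattern : ℕ → Set
Pattern = Vec (Maybe Bool)

data Matches : Maybe Bool → Bool → Set where
  any   : ∀ {b} → Matches nothing b
  fixed : ∀ {b} → Matches (just b) b

-- The number of full assignments that match the pattern: only the free positions leave a choice.
weight : ∀ {N} → Pattern N → ℕ
weight []            = 1
weight (nothing ∷ p) = 2 * weight p
weight (just _ ∷ p)  = weight p

weights : ∀ {N} → List (Pattern N) → ℕ
weights = sum ∘ map weight

-- Conditioning on the first bit: a pattern that contradicts `b` can no longer be matched and is
-- dropped.
restrict : ∀ {N} → Bool → List (Pattern (suc N)) → List (Pattern N)
restrict b []                      = []
restrict b ((nothing ∷ p) ∷ ps)    = p ∷ restrict b ps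
restrict b ((just b′ ∷ p) ∷ ps) with b′ Bool.≟ b
... | yes _ = p ∷ restrict b ps
... | no  _ = restrict b ps

∈-restrict : ∀ {N b m p} (ps : List (Pattern (suc N))) →
             (m ∷ p) ∈ ps → Matches m b → p ∈ restrict b ps
∈-restrict ((nothing ∷ p) ∷ ps) (here refl) any = here refl
∈-restrict {b = b} ((just b ∷ p) ∷ ps) (here refl) fixed with b Bool.≟ b
... | yes _  = here refl
... | no b≢b = contradiction refl b≢b
∈-restrict ((nothing ∷ _) ∷ ps) (there p∈ps) m = there (∈-restrict ps p∈ps m)
∈-restrict {b = b} ((just b′ ∷ _) ∷ ps) (there p∈ps) m with b′ Bool.≟ b
... | yes _ = there (∈-restrict ps p∈ps m)
... | no  _ = ∈-restrict ps p∈ps m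

-- A free first position keeps the tail for both bits, which accounts for its factor 2; a fixed one
-- keeps it for exactly one bit.
weights-restrict : ∀ {N} (ps : List (Pattern (suc N))) →
                   weights (restrict false ps) + weights (restrict true ps) ≡ weights ps
weights-restrict [] = refl
weights-restrict ((nothing ∷ p) ∷ ps) = begin
  (w + F) + (w + T)   ≡⟨ solve 3 (λ w F T → (w :+ F) :+ (w :+ T) := (con 2 :* w) :+ (F :+ T)) refl w F T ⟩
  2 * w + (F + T)     ≡⟨ cong (2 * w +_) (weights-restrict ps) ⟩
  2 * w + weights ps  ∎
  where
  open ≡-Reasoning
  w = weight p
  F = weights (restrict false ps)
  T = weights (restrict true ps)
weights-restrict ((just false ∷ p) ∷ ps) =
  trans (+-assoc (weight p) _ _) (cong (weight p +_) (weights-restrict ps))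
weights-restrict ((just true ∷ p) ∷ ps) =
  trans (+-CS.x∙yz≈y∙xz (weights (restrict false ps)) (weight p) _) (cong (weight p +_) (weights-restrict ps))

-- The method of conditional expectations: weight p / 2 ^ N is the probability that
-- a random assignment matches p, and fixing the first bit suitably does not
-- increase the expected number of matched patterns.
avoid : ∀ {N} (ps : List (Pattern N)) → weights ps ℕ.< 2 ^ N →
        ∃ λ (a : Vec Bool N) → ∀ {p} → p ∈ ps → ¬ Pointwise Matches p a
avoid {zero}  []        _ = [] , λ ()
-- The empty pattern has weight 1 and always matches; the strictness of the bound by `2 ^ 0`
-- excludes it.
avoid {zero}  ([] ∷ ps) (s≤s ())
avoid {suc N} ps        ps< = choose (<-≤-connex (weights (restrict false ps)) (2 ^ N))
  where
  extend : ∀ b → weights (restrict b ps) ℕ.< 2 ^ N →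
           ∃ λ (a : Vec Bool (suc N)) → ∀ {p} → p ∈ ps → ¬ Pointwise Matches p a
  extend b small with avoid (restrict b ps) small
  ... | a , avoids = b ∷ a , λ { p∈ps (m ∷ ms) → avoids (∈-restrict ps p∈ps m) ms }
  choose : _ → _
  choose (inj₁ small) = extend false small
  choose (inj₂ large) = extend true (+-cancelˡ-< (2 ^ N) _ _ (begin-strict
    2 ^ N + weights (restrict true ps)                       ≤⟨ +-monoˡ-≤ _ large ⟩
    weights (restrict false ps) + weights (restrict true ps) ≡⟨ weights-restrict ps ⟩
    weights ps                                               <⟨ ps< ⟩
    2 ^ N + (2 ^ N + 0)                                      ≡⟨ cong (2 ^ N +_) (+-identityʳ _) ⟩
    2 ^ N + 2 ^ N                                            ∎))
    where open ≤-Reasoning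

-- Monochromatic rectangles as patterns, and their number.

subsets : (n t : ℕ) → List (Subset n)
subsets zero    zero    = [] ∷ []
subsets zero    (suc t) = []
subsets (suc n) zero    = map (outside ∷_) (subsets n zero)
subsets (suc n) (suc t) = map (inside ∷_) (subsets n t) ++ map (outside ∷_) (subsets n (suc t))

-- A crude bound on the binomial coefficient: Pascal's rule gives at most `n ^ t + n ^ suc t`, which
-- is `suc n * n ^ t` by computation.
length-subsets-≤ : ∀ n t → length (subsets n t) ≤ n ^ t
length-subsets-≤ zero    zero    = ≤-refl
length-subsets-≤ zero    (suc t) = z≤n
length-subsets-≤ (suc n) zero    = ≤-trans (≤-reflexive (length-map _ (subsets n zero))) (length-subsets-≤ n zero)
length-subsets-≤ (suc n) (suc t) = begin
  length (map (inside ∷_) (subsets n t) ++ map (outside ∷_) (subsets n (suc t)))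
    ≡⟨ length-++ (map (inside ∷_) (subsets n t)) ⟩
  length (map (inside ∷_) (subsets n t)) + length (map (outside ∷_) (subsets n (suc t)))
    ≡⟨ cong₂ _+_ (length-map _ (subsets n t)) (length-map _ (subsets n (suc t))) ⟩
  length (subsets n t) + length (subsets n (suc t))
    ≤⟨ +-mono-≤ (length-subsets-≤ n t) (length-subsets-≤ n (suc t)) ⟩
  suc n * n ^ t
    ≤⟨ *-monoʳ-≤ (suc n) (^-monoˡ-≤ t (n≤1+n n)) ⟩
  suc n * suc n ^ t ∎
  where open ≤-Reasoning

∈-subsets⇒∣∣≡ : ∀ n t {p} → p ∈ subsets n t → ∣ p ∣ ≡ t
∈-subsets⇒∣∣≡ zero    zero    (here refl) = refl
∈-subsets⇒∣∣≡ (suc n) zero    p∈ with ∈-map⁻ (outside ∷_) p∈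
... | _ , q∈ , refl = ∈-subsets⇒∣∣≡ n zero q∈
∈-subsets⇒∣∣≡ (suc n) (suc t) p∈ with ∈-++⁻ (map (inside ∷_) (subsets n t)) p∈
... | inj₁ p∈ˡ with _ , q∈ , refl ← ∈-map⁻ (inside ∷_) p∈ˡ  = cong suc (∈-subsets⇒∣∣≡ n t q∈)
... | inj₂ p∈ʳ with _ , q∈ , refl ← ∈-map⁻ (outside ∷_) p∈ʳ = ∈-subsets⇒∣∣≡ n (suc t) q∈

-- Reduces rectangles with sides of length at least `t` to those with sides of length exactly `t`,
-- over which the union bound runs.
shrink : ∀ {n} t (p : Subset n) → t ≤ ∣ p ∣ → ∃ λ q → q ∈ subsets n t × q Subset.⊆ p
shrink zero    []            _         = [] , here refl , id
shrink zero    (s ∷ p)       _         with q , q∈ , q⊆p ← shrink zero p z≤n =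
  outside ∷ q , ∈-map⁺ (outside ∷_) q∈ , out⊆ q⊆p
shrink (suc t) (inside ∷ p)  (s≤s t≤p) with q , q∈ , q⊆p ← shrink t p t≤p =
  inside ∷ q , ∈-++⁺ˡ (∈-map⁺ (inside ∷_) q∈) , in⊆in q⊆p
shrink (suc t) (outside ∷ p) t≤p       with q , q∈ , q⊆p ← shrink (suc t) p t≤p =
  outside ∷ q , ∈-++⁺ʳ _ (∈-map⁺ (outside ∷_) q∈) , out⊆ q⊆p

fromList : ∀ {n} → List (Fin n) → Subset n
fromList []       = Subset.⊥
fromList (x ∷ xs) = ⁅ x ⁆ ∪ fromList xs

∈-fromList⁻ : ∀ {n} (xs : List (Fin n)) {x} → x Subset.∈ fromList xs → x ∈ xs
∈-fromList⁻ []       x∈ = contradiction x∈ ∉⊥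
∈-fromList⁻ (y ∷ xs) x∈ with x∈p∪q⁻ ⁅ y ⁆ (fromList xs) x∈
... | inj₁ x∈⁅y⁆ = here (x∈⁅y⁆⇒x≡y y x∈⁅y⁆)
... | inj₂ x∈xs  = there (∈-fromList⁻ xs x∈xs)

-- Adjoining an element that does not occur in the rest of the list makes the inclusion strict, so
-- every entry raises the cardinality.
length≤∣fromList∣ : ∀ {n} {xs : List (Fin n)} → Unique xs → length xs ≤ ∣ fromList xs ∣
length≤∣fromList∣ []                         = z≤n
length≤∣fromList∣ {xs = x ∷ xs} u@(_ ∷ uxs) = ≤-trans (s≤s (length≤∣fromList∣ uxs))
  (p⊂q⇒∣p∣<∣q∣
    ( q⊆p∪q ⁅ x ⁆ (fromList xs)
    , x
    , p⊆p∪q (fromList xs) (x∈⁅x⁆ x)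
    , Unique.Unique[x∷xs]⇒x∉xs u ∘ ∈-fromList⁻ xs))

rowPattern : ∀ {n} → Bool → Subset n → Pattern n
rowPattern c []            = []
rowPattern c (inside ∷ Y)  = just c ∷ rowPattern c Y
rowPattern c (outside ∷ Y) = nothing ∷ rowPattern c Y

free : ∀ n → Pattern n
free n = Vec.replicate n nothing

-- The event that `X × Y` is monochromatic of colour `c`, kept row by row; `Vec.concat` turns it
-- into one pattern on all `m * n` entries of the table.
rectangle : ∀ {m n} → Bool → Subset m → Subset n → Vec (Pattern n) m
rectangle c []            Y = []
rectangle c (inside ∷ X)  Y = rowPattern c Y ∷ rectangle c X Y
rectangle c (outside ∷ X) Y = free _ ∷ rectangle c X Y

weight-++ : ∀ {m n} (p : Pattern m) (q : Pattern n) → weight (p Vec.++ q) ≡ weight p * weight q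
weight-++ []            q = sym (+-identityʳ _)
weight-++ (nothing ∷ p) q = trans (cong (2 *_) (weight-++ p q)) (sym (*-assoc 2 (weight p) _))
weight-++ (just _ ∷ p)  q = weight-++ p q

weight-free : ∀ n → weight (free n) ≡ 2 ^ n
weight-free zero    = refl
weight-free (suc n) = cong (2 *_) (weight-free n)

weight-rowPattern : ∀ {n} c (Y : Subset n) → weight (rowPattern c Y) * 2 ^ ∣ Y ∣ ≡ 2 ^ n
weight-rowPattern c []            = refl
weight-rowPattern c (inside ∷ Y)  = trans (*-CS.x∙yz≈y∙xz (weight (rowPattern c Y)) 2 _) (cong (2 *_) (weight-rowPattern c Y))
weight-rowPattern c (outside ∷ Y) = trans (*-assoc 2 (weight (rowPattern c Y)) _) (cong (2 *_) (weight-rowPattern c Y))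

-- The rectangle fixes `∣ X ∣ * ∣ Y ∣` of the `m * n` bits. The corresponding power of 2 stands on
-- the left to avoid a subtraction in the exponent.
weight-rectangle : ∀ {m n} c (X : Subset m) (Y : Subset n) →
  weight (Vec.concat (rectangle c X Y)) * 2 ^ (∣ X ∣ * ∣ Y ∣) ≡ 2 ^ (m * n)
weight-rectangle c [] Y = refl
weight-rectangle {suc m} {n} c (inside ∷ X) Y = begin
  weight (rowPattern c Y Vec.++ R) * 2 ^ (∣ Y ∣ + ∣ X ∣ * ∣ Y ∣)
    ≡⟨ cong₂ _*_ (weight-++ (rowPattern c Y) R) (^-distribˡ-+-* 2 ∣ Y ∣ (∣ X ∣ * ∣ Y ∣)) ⟩
  (weight (rowPattern c Y) * weight R) * (2 ^ ∣ Y ∣ * 2 ^ (∣ X ∣ * ∣ Y ∣))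
    ≡⟨ [m*n]*[o*p]≡[m*o]*[n*p] (weight (rowPattern c Y)) (weight R) (2 ^ ∣ Y ∣) _ ⟩
  (weight (rowPattern c Y) * 2 ^ ∣ Y ∣) * (weight R * 2 ^ (∣ X ∣ * ∣ Y ∣))
    ≡⟨ cong₂ _*_ (weight-rowPattern c Y) (weight-rectangle c X Y) ⟩
  2 ^ n * 2 ^ (m * n)
    ≡⟨ sym (^-distribˡ-+-* 2 n (m * n)) ⟩
  2 ^ (n + m * n) ∎
  where
  open ≡-Reasoning
  R = Vec.concat (rectangle c X Y)
weight-rectangle {suc m} {n} c (outside ∷ X) Y = begin
  weight (free n Vec.++ R) * 2 ^ (∣ X ∣ * ∣ Y ∣)
    ≡⟨ cong (_* 2 ^ (∣ X ∣ * ∣ Y ∣)) (weight-++ (free n) R) ⟩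
  weight (free n) * weight R * 2 ^ (∣ X ∣ * ∣ Y ∣)
    ≡⟨ *-assoc (weight (free n)) (weight R) _ ⟩
  weight (free n) * (weight R * 2 ^ (∣ X ∣ * ∣ Y ∣))
    ≡⟨ cong₂ _*_ (weight-free n) (weight-rectangle c X Y) ⟩
  2 ^ n * 2 ^ (m * n)
    ≡⟨ sym (^-distribˡ-+-* 2 n (m * n)) ⟩
  2 ^ (n + m * n) ∎
  where
  open ≡-Reasoning
  R = Vec.concat (rectangle c X Y)

rowPattern-matches : ∀ {n} c (Y : Subset n) (v : Vec Bool n) →
  (∀ {y} → y Subset.∈ Y → lookup v y ≡ c) → Pointwise Matches (rowPattern c Y) v
rowPattern-matches c []            []      mono = []
rowPattern-matches c (inside ∷ Y)  (b ∷ v) mono =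
  subst (Matches (just c)) (sym (mono Vec.here)) fixed ∷ rowPattern-matches c Y v (mono ∘ Vec.there)
rowPattern-matches c (outside ∷ Y) (b ∷ v) mono = any ∷ rowPattern-matches c Y v (mono ∘ Vec.there)

free-matches : ∀ {n} (v : Vec Bool n) → Pointwise Matches (free n) v
free-matches []      = []
free-matches (b ∷ v) = any ∷ free-matches v

rectangle-matches : ∀ {m n} c (X : Subset m) (Y : Subset n) (φ : Vec (Vec Bool n) m) →
  (∀ {x y} → x Subset.∈ X → y Subset.∈ Y → lookup (lookup φ x) y ≡ c) →
  Pointwise (Pointwise Matches) (rectangle c X Y) φ
rectangle-matches c []            Y []      mono = []
rectangle-matches c (inside ∷ X)  Y (v ∷ φ) mono =
  rowPattern-matches c Y v (mono Vec.here) ∷ rectangle-matches c X Y φ (mono ∘ Vec.there)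
rectangle-matches c (outside ∷ X) Y (v ∷ φ) mono =
  free-matches v ∷ rectangle-matches c X Y φ (mono ∘ Vec.there)

rectangles : (n t : ℕ) → Bool → List (Pattern (n * n))
rectangles n t c = cartesianProductWith (λ X Y → Vec.concat (rectangle c X Y)) (subsets n t) (subsets n t)

sum-*ʳ : ∀ {A : Set} (f : A → ℕ) {d e} (xs : List A) → (∀ {x} → x ∈ xs → f x * d ≡ e) →
         sum (map f xs) * d ≡ length xs * e
sum-*ʳ f     []       eq = refl
sum-*ʳ f {d} (x ∷ xs) eq = trans (*-distribʳ-+ d (f x) _)
  (cong₂ _+_ (eq (here refl)) (sum-*ʳ f xs (eq ∘ there)))

weights-rectangles : ∀ n t c →
  weights (rectangles n t c) * 2 ^ (t * t) ≤ (n ^ t * n ^ t) * 2 ^ (n * n)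
weights-rectangles n t c = begin
  weights (rectangles n t c) * 2 ^ (t * t)
    ≡⟨ sum-*ʳ weight (rectangles n t c) weight≡ ⟩
  length (rectangles n t c) * 2 ^ (n * n)
    ≡⟨ cong (_* 2 ^ (n * n)) (length-cartesianProductWith _ (subsets n t) (subsets n t)) ⟩
  (length (subsets n t) * length (subsets n t)) * 2 ^ (n * n)
    ≤⟨ *-monoˡ-≤ (2 ^ (n * n)) (*-mono-≤ (length-subsets-≤ n t) (length-subsets-≤ n t)) ⟩
  (n ^ t * n ^ t) * 2 ^ (n * n) ∎
  where
  open ≤-Reasoning
  weight≡ : ∀ {p} → p ∈ rectangles n t c → weight p * 2 ^ (t * t) ≡ 2 ^ (n * n)
  weight≡ p∈ with ∈-cartesianProductWith⁻ _ (subsets n t) (subsets n t) p∈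
  ... | X , Y , X∈ , Y∈ , refl = subst₂ (λ x y → weight (Vec.concat (rectangle c X Y)) * 2 ^ (x * y) ≡ 2 ^ (n * n))
    (∈-subsets⇒∣∣≡ n t X∈) (∈-subsets⇒∣∣≡ n t Y∈) (weight-rectangle c X Y)

-- Chosen so that `t = side r` gives `2 * r * t + 1 < t * t` for every `r`, including `r = 0`.
side : ℕ → ℕ
side r = suc (suc (2 * r))

-- A union bound over the rectangles of side t = 2 r + 2: there are at most n²ᵗ of them
-- for each colour, and each is monochromatic with probability 2^(- t²).
balanced-colouring : ∀ r → let n = 2 ^ r in
  Σ (Fin n → Fin n → Bool) λ φ → ∀ c {xs ys} → Unique xs → Unique ys →
  side r ≤ length xs → side r ≤ length ys →
  ¬ (∀ {x y} → x ∈ xs → y ∈ ys → φ x y ≡ c)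
balanced-colouring r = φ , no-mono
  where
  n = 2 ^ r
  t = side r
  all-rectangles = rectangles n t false ++ rectangles n t true

  few : weights all-rectangles ℕ.< 2 ^ (n * n)
  few = *-cancelʳ-< (2 ^ (t * t)) _ _ (begin-strict
    weights all-rectangles * 2 ^ (t * t)
      ≡⟨ cong (_* 2 ^ (t * t)) (trans (cong sum (map-++ weight (rectangles n t false) _)) (sum-++ (map weight (rectangles n t false)) _)) ⟩
    (weights (rectangles n t false) + weights (rectangles n t true)) * 2 ^ (t * t)
      ≡⟨ *-distribʳ-+ (2 ^ (t * t)) (weights (rectangles n t false)) _ ⟩
    weights (rectangles n t false) * 2 ^ (t * t) + weights (rectangles n t true) * 2 ^ (t * t)
      ≤⟨ +-mono-≤ (weights-rectangles n t false) (weights-rectangles n t true) ⟩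
    (n ^ t * n ^ t) * 2 ^ (n * n) + (n ^ t * n ^ t) * 2 ^ (n * n)
      ≡⟨ cong (λ z → z * 2 ^ (n * n) + z * 2 ^ (n * n)) nᵗnᵗ≡ ⟩
    2 ^ (r * t + r * t) * 2 ^ (n * n) + 2 ^ (r * t + r * t) * 2 ^ (n * n)
      ≡⟨ cong (2 ^ (r * t + r * t) * 2 ^ (n * n) +_) (sym (+-identityʳ _)) ⟩
    2 * (2 ^ (r * t + r * t) * 2 ^ (n * n))
      ≡⟨ sym (*-assoc 2 (2 ^ (r * t + r * t)) _) ⟩
    2 ^ suc (r * t + r * t) * 2 ^ (n * n)
      <⟨ *-monoˡ-< (2 ^ (n * n)) {{m^n≢0 2 (n * n)}} (^-monoʳ-< 2 (s≤s (s≤s z≤n)) exponent<) ⟩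
    2 ^ (t * t) * 2 ^ (n * n)
      ≡⟨ *-comm (2 ^ (t * t)) _ ⟩
    2 ^ (n * n) * 2 ^ (t * t) ∎)
    where
    open ≤-Reasoning
    nᵗnᵗ≡ : n ^ t * n ^ t ≡ 2 ^ (r * t + r * t)
    nᵗnᵗ≡ = trans (cong₂ _*_ (^-*-assoc 2 r t) (^-*-assoc 2 r t)) (sym (^-distribˡ-+-* 2 (r * t) (r * t)))
    exponent< : suc (r * t + r * t) ℕ.< t * t
    exponent< = begin-strict
      -- The square `t * t` exceeds `2 * r * t` by `2 * t = 4 * r + 4`: one unit pays for the two
      -- colours, the other `4 * r + 3` make the inequality strict.
      suc (r * t + r * t)            <⟨ s≤s (m<m+n (r * t + r * t) (s≤s z≤n)) ⟩
      suc (r * t + r * t + suc (4 * r + 2))  ≡⟨ solve 1 (λ r → let t = con 2 :+ con 2 :* r in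
                                            con 1 :+ ((r :* t :+ r :* t) :+ (con 1 :+ (con 4 :* r :+ con 2))) := t :* t) refl r ⟩
      t * t                          ∎

  assignment = avoid all-rectangles few
  table = Vec.group n n (proj₁ assignment)

  φ : Fin n → Fin n → Bool
  φ x y = lookup (lookup (proj₁ table) x) y

  avoided : ∀ c {X Y} → X ∈ subsets n t → Y ∈ subsets n t → Vec.concat (rectangle c X Y) ∈ all-rectangles
  avoided false X∈ Y∈ = ∈-++⁺ˡ (∈-cartesianProductWith⁺ _ X∈ Y∈)
  avoided true  X∈ Y∈ = ∈-++⁺ʳ (rectangles n t false) (∈-cartesianProductWith⁺ _ X∈ Y∈)

  no-mono : ∀ c {xs ys} → Unique xs → Unique ys → t ≤ length xs → t ≤ length ys →
            ¬ (∀ {x y} → x ∈ xs → y ∈ ys → φ x y ≡ c)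
  no-mono c {xs} {ys} uxs uys t≤xs t≤ys mono
    with X , X∈ , X⊆ ← shrink t (fromList xs) (≤-trans t≤xs (length≤∣fromList∣ uxs))
       | Y , Y∈ , Y⊆ ← shrink t (fromList ys) (≤-trans t≤ys (length≤∣fromList∣ uys)) =
    proj₂ assignment (avoided c X∈ Y∈)
      (subst (Pointwise Matches _) (sym (proj₂ table))
        (Pointwise.concat⁺ (rectangle-matches c X Y (proj₁ table)
          (λ x∈X y∈Y → mono (∈-fromList⁻ xs (X⊆ x∈X)) (∈-fromList⁻ ys (Y⊆ y∈Y))))))

-- Treelike circuits

module TreelikeCircuit {a b} (C : Circuit (Fin a) (Fin b))
  (wellDefined : Circuit.WellDefined C) (treelike : Circuit.Treelike C) where

  open Circuit C
  open WellDefined wellDefined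

  Wire⁺-isStrictPartialOrder : IsStrictPartialOrder _≡_ (TransClosure Wire)
  Wire⁺-isStrictPartialOrder = record
    { isEquivalence = isEquivalence
    ; irrefl        = λ { refl → acyclic _ }
    ; trans         = transitive Wire
    ; <-resp-≈      = resp₂ (TransClosure Wire)
    }

  Wire-wellFounded : WellFounded Wire
  Wire-wellFounded = Subrelation.wellFounded [_] (spo-wellFounded Wire⁺-isStrictPartialOrder)

  Wire-noetherian : WellFounded (flip Wire)
  Wire-noetherian = Subrelation.wellFounded [_] (spo-noetherian Wire⁺-isStrictPartialOrder)

  child⇒¬input : ∀ {g′ g x y} → Wire g′ g → label g ≢ x ↦ y
  child⇒¬input {g′} {g} w eq = Equivalence.from (input-label g) (_ , _ , eq) g′ w

  ¬input⇒child : ∀ {g} → (∀ {x y} → label g ≢ x ↦ y) → ∃ λ g′ → Wire g′ g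
  ¬input⇒child {g} ¬input with Fin.any? (λ g′ → wire? g′ g)
  ... | yes g′,w = g′,w
  ... | no ¬child with _ , _ , eq ← Equivalence.to (input-label g) (λ g′ w → ¬child (g′ , w)) =
    contradiction eq ¬input

  -- Some input gate `x ↦ y` lies at or below `g`. By `S⇒Value` and `Value⇒S` this means that some
  -- map in `S g` sends `x` to `y`, but in this form it can be decided by a search along the wires.
  data Value (g : Gate) (x : Fin a) (y : Fin b) : Set where
    input : label g ≡ x ↦ y → Value g x y
    child : ∀ {g′} → Wire g′ g → Value g′ x y → Value g x y

  value? : ∀ g x y → Dec (Value g x y)
  value? g x y = go (Wire-wellFounded g)
    where
    label? : ∀ g → Dec (label g ≡ x ↦ y)
    label? g with label g
    ... | ∪-gate = no λ ()
    ... | ×-gate = no λ ()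
    ... | x′ ↦ y′ = map′ (λ { (refl , refl) → refl }) (λ { refl → refl , refl })
                         ((x′ Fin.≟ x) ×-dec (y′ Fin.≟ y))
    go : ∀ {g} → Acc Wire g → Dec (Value g x y)
    child-value? : ∀ {g} → Acc Wire g → ∀ g′ → Dec (Wire g′ g × Value g′ x y)
    go {g} (acc rec) with label? g | Fin.any? (child-value? (acc rec))
    ... | yes eq | _                = yes (input eq)
    ... | no _   | yes (_ , w , v)  = yes (child w v)
    ... | no ≢in | no ¬child        = no λ { (input eq) → ≢in eq ; (child w v) → ¬child (_ , w , v) }
    child-value? {g} (acc rec) g′ with wire? g′ g
    ... | no ¬w = no (¬w ∘ proj₁)
    ... | yes w = map′ (w ,_) proj₂ (go (rec w))

  Value⇒dom : ∀ {g x y} → Value g x y → x Unary.∈ dom g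
  Value⇒dom (input eq)  = input eq
  Value⇒dom (child w v) = child w (Value⇒dom v)

  dom⇒Value : ∀ {g x} → x Unary.∈ dom g → ∃ λ y → Value g x y
  dom⇒Value (input eq)                             = _ , input eq
  dom⇒Value (child w x∈) with y , v ← dom⇒Value x∈ = y , child w v

  dom? : ∀ g x → Dec (x Unary.∈ dom g)
  dom? g x = map′ (Value⇒dom ∘ proj₂) dom⇒Value (Fin.any? (value? g x))

  S⇒Value : ∀ {g f x y} → f Unary.∈ S g → f x ≡ just y → Value g x y
  S⇒Value (input eq f⇔) fx with refl , refl ← Equivalence.to (f⇔ _ _) fx = input eq
  S⇒Value (union _ w s) fx = child w (S⇒Value s fx)
  S⇒Value (times _ h hs f⇔) fx with _ , w , hx ← Equivalence.to (f⇔ _ _) fx = child w (S⇒Value (hs w) hx)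

  same-child : ∀ {g g₁ g₂ x} → label g ≡ ×-gate → Wire g₁ g → Wire g₂ g →
               x Unary.∈ dom g₁ → x Unary.∈ dom g₂ → g₁ ≡ g₂
  same-child {g₁ = g₁} {g₂} eq w₁ w₂ x∈₁ x∈₂ with g₁ Fin.≟ g₂
  ... | yes g₁≡g₂ = g₁≡g₂
  ... | no  g₁≢g₂ = contradiction (x∈₁ , x∈₂) (×-dom eq w₁ w₂ g₁≢g₂)

  singleton : Fin a → Fin b → Fin a ⇀ Fin b
  singleton x y x′ with x′ Fin.≟ x
  ... | yes _ = just y
  ... | no  _ = nothing

  singleton-at : ∀ x y → singleton x y x ≡ just y
  singleton-at x y with x Fin.≟ x
  ... | yes _  = refl
  ... | no x≢x = contradiction refl x≢x

  singleton∈S : ∀ {g x y} → label g ≡ x ↦ y → singleton x y Unary.∈ S g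
  singleton∈S {x = x} {y} eq = input eq λ x′ y′ → mk⇔ (to x′) (λ { (refl , refl) → singleton-at x y })
    where
    to : ∀ x′ {y′} → singleton x y x′ ≡ just y′ → x′ ≡ x × y′ ≡ y
    to x′ e with x′ Fin.≟ x
    to x′ refl | yes x′≡x = x′≡x , refl

  -- Children of a ×-gate have disjoint domains, so the maps chosen at them have a union that is
  -- again a map. A search finds a child defined at `x`, and `same-child` shows that there is no
  -- other.
  merge : ∀ {g} → label g ≡ ×-gate → (h : Gate → Fin a ⇀ Fin b) → (∀ {g′} → Wire g′ g → h g′ Unary.∈ S g′) →
          ∃ λ f → f Unary.∈ S g × (∀ {g′ x y} → Wire g′ g → h g′ x ≡ just y → f x ≡ just y)
  merge {g} eq h hs = f , times eq h hs (λ x y → mk⇔ (to x) (λ (_ , w , hx) → from w hx)) , from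
    where
    defined? : ∀ x g′ → Dec (Wire g′ g × ∃ λ y → h g′ x ≡ just y)
    defined? x g′ with wire? g′ g | h g′ x in hx
    ... | no ¬w | _       = no (¬w ∘ proj₁)
    ... | yes w | just y  = yes (w , y , refl)
    ... | yes w | nothing = no λ ()

    f : Fin a ⇀ Fin b
    f x with Fin.any? (defined? x)
    ... | yes (_ , _ , y , _) = just y
    ... | no _                = nothing

    to : ∀ x {y} → f x ≡ just y → ∃ λ g′ → Wire g′ g × h g′ x ≡ just y
    to x fx with Fin.any? (defined? x)
    to x refl | yes (g′ , w , _ , hx) = g′ , w , hx

    from : ∀ {g′ x y} → Wire g′ g → h g′ x ≡ just y → f x ≡ just y
    from {g′} {x} w hx with Fin.any? (defined? x)
    ... | no ¬def = contradiction (g′ , w , _ , hx) ¬def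
    ... | yes (g″ , w″ , y″ , hx″)
      with refl ← same-child eq w″ w (Value⇒dom (S⇒Value (hs w″) hx″)) (Value⇒dom (S⇒Value (hs w) hx)) =
      trans (sym hx″) hx

  -- Provides filler maps at the remaining children of a ×-gate when maps are prescribed at only one
  -- or two of them.
  S-inhabited : ∀ g → ∃ λ f → f Unary.∈ S g
  S-inhabited g = go (Wire-wellFounded g)
    where
    go : ∀ {g} → Acc Wire g → ∃ λ f → f Unary.∈ S g
    go {g} (acc rec) with label g in eq
    ... | x ↦ y = singleton x y , singleton∈S eq
    ... | ∪-gate with g′ , w ← ¬input⇒child (λ e → contradiction (trans (sym eq) e) λ ())
      with f , s ← go (rec w) = f , union eq w s
    ... | ×-gate = let f , s , _ = merge eq h hs in f , s
      where
      h : Gate → Fin a ⇀ Fin b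
      h g′ with wire? g′ g
      ... | yes w = proj₁ (go (rec w))
      ... | no _  = λ _ → nothing
      hs : ∀ {g′} → Wire g′ g → h g′ Unary.∈ S g′
      hs {g′} w with wire? g′ g
      ... | yes w′ = proj₂ (go (rec w′))
      ... | no ¬w  = contradiction w ¬w

  Choice : Set
  Choice = ∀ g → ∃ λ f → f Unary.∈ S g

  _[_≔_] : Choice → ∀ g → ∃ (Unary._∈ S g) → Choice
  (χ [ g ≔ s ]) g′ with g′ Fin.≟ g
  ... | yes refl = s
  ... | no _     = χ g′

  ≔-same : ∀ χ g s → (χ [ g ≔ s ]) g ≡ s
  ≔-same χ g s with g Fin.≟ g
  ... | yes refl = refl
  ... | no g≢g   = contradiction refl g≢g

  ≔-other : ∀ χ {g g′} s → g′ ≢ g → (χ [ g ≔ s ]) g′ ≡ χ g′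
  ≔-other χ {g} {g′} s g′≢g with g′ Fin.≟ g
  ... | yes g′≡g = contradiction g′≡g g′≢g
  ... | no _     = refl

  merge-choice : ∀ {g} → label g ≡ ×-gate → (χ : Choice) →
    ∃ λ f → f Unary.∈ S g × (∀ {g′ x y} → Wire g′ g → proj₁ (χ g′) x ≡ just y → f x ≡ just y)
  merge-choice eq χ = merge eq (proj₁ ∘ χ) (λ {g′} _ → proj₂ (χ g′))

  -- A ∪-gate passes the map on unchanged; at a ×-gate the other children contribute their filler
  -- maps.
  S-up : ∀ {g p f} → Wire g p → f Unary.∈ S g →
         ∃ λ f′ → f′ Unary.∈ S p × (∀ {x y} → f x ≡ just y → f′ x ≡ just y)
  S-up {g} {p} {f} w s with label p in eq
  ... | x ↦ y  = contradiction eq (child⇒¬input w)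
  ... | ∪-gate = f , union eq w s , id
  ... | ×-gate with f′ , s′ , ⊇ ← merge-choice eq (S-inhabited [ g ≔ f , s ]) =
    f′ , s′ , λ fx → ⊇ w (trans (cong (λ z → proj₁ z _) (≔-same S-inhabited g (f , s))) fx)

  Value⇒S : ∀ {g x y} → Value g x y → ∃ λ f → f Unary.∈ S g × f x ≡ just y
  Value⇒S (input eq) = _ , singleton∈S eq , singleton-at _ _
  Value⇒S (child w v) with f , s , fx ← Value⇒S v with f′ , s′ , ⊇ ← S-up w s = f′ , s′ , ⊇ fx

  -- Iterates `S-up` along parents; by acyclicity and finiteness the walk ends, and it can end only
  -- at the sink.
  S-extend : ∀ {g f} → f Unary.∈ S g →
             ∃ λ F → F Unary.∈ S sink × (∀ {x y} → f x ≡ just y → F x ≡ just y)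
  S-extend {g} = go (Wire-noetherian g)
    where
    go : ∀ {g f} → Acc (flip Wire) g → f Unary.∈ S g →
         ∃ λ F → F Unary.∈ S sink × (∀ {x y} → f x ≡ just y → F x ≡ just y)
    go {g} (acc rec) s with g Fin.≟ sink
    ... | yes refl = _ , s , id
    ... | no g≢sink with p , w , _ ← treelike g g≢sink
                    with f′ , s′ , ⊇ ← S-up w s
                    with F , S′ , ⊇′ ← go (rec w) s′ = F , S′ , ⊇′ ∘ ⊇

  values : Gate → Fin a → List (Fin b)
  values g x = filter (value? g x) (allFin b)

  ∈-values⁻ : ∀ {g x y} → y ∈ values g x → Value g x y
  ∈-values⁻ {g} {x} = proj₂ ∘ ∈-filter⁻ (value? g x) {xs = allFin b}

  ∈-values⁺ : ∀ {g x y} → Value g x y → y ∈ values g x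
  ∈-values⁺ {g} {x} = ∈-filter⁺ (value? g x) (∈-allFin _)

  -- A ×-gate combines maps of distinct children freely, and the result extends to the sink. This
  -- independence is what makes the value lists of two children a biclique in the target graph.
  values-jointly-attained : ∀ {g g₁ g₂ x₁ x₂ y₁ y₂} → label g ≡ ×-gate →
    Wire g₁ g → Wire g₂ g → g₁ ≢ g₂ → Value g₁ x₁ y₁ → Value g₂ x₂ y₂ →
    ∃ λ F → F Unary.∈ S sink × F x₁ ≡ just y₁ × F x₂ ≡ just y₂
  values-jointly-attained {g} {g₁} {g₂} eq w₁ w₂ g₁≢g₂ v₁ v₂
    with f₁ , s₁ , fx₁ ← Value⇒S v₁
    with f₂ , s₂ , fx₂ ← Value⇒S v₂
    with f , s , ⊇ ← merge-choice eq ((S-inhabited [ g₁ ≔ f₁ , s₁ ]) [ g₂ ≔ f₂ , s₂ ])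
    with F , S′ , ⊇′ ← S-extend s =
    F , S′
    , ⊇′ (⊇ w₁ (trans (cong (λ z → proj₁ z _) (trans (≔-other _ _ g₁≢g₂) (≔-same _ g₁ (f₁ , s₁)))) fx₁))
    , ⊇′ (⊇ w₂ (trans (cong (λ z → proj₁ z _) (≔-same _ g₂ (f₂ , s₂))) fx₂))

  -- Small siblings along a path, and the number of maps per gate.

  module _ (T : ℕ) where

    Small : Gate → Set
    Small g = ∀ x → length (values g x) ≤ T

    small? : ∀ g → Dec (Small g)
    small? g = Fin.all? λ x → length (values g x) ≤? T

    -- The values contributed by the small branches that hang off a path from `v` towards the sink
    -- at its ×-gates.
    data Context (v : Gate) (x : Fin a) (y : Fin b) : Set where
      sibling : ∀ {p g} → Wire v p → label p ≡ ×-gate → Wire g p → g ≢ v → Small g → Value g x y → Context v x y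
      up   : ∀ {p} → Wire v p → Context p x y → Context v x y

    -- The domain of the sibling is disjoint from that of the path gate beside it, and domains only
    -- grow on the way up from `v`.
    Context⇒∉dom : ∀ {v x y} → Context v x y → ¬ (x Unary.∈ dom v)
    Context⇒∉dom (sibling w eq w′ g≢v _ val) x∈ = ×-dom eq w′ w g≢v (Value⇒dom val , x∈)
    Context⇒∉dom (up w ctx) x∈ = Context⇒∉dom ctx (child w x∈)

    Context-path : ∀ {v g x y} → Star Wire v g → Context g x y → Context v x y
    Context-path ε        ctx = ctx
    Context-path (w ◅ ws) ctx = up w (Context-path ws ctx)

    -- Uniqueness of parents makes the path from v to the sink unique, so
    -- that at most one small sibling is responsible for x.
    context-values : ∀ v x → ∃ λ ys → length ys ≤ T × (∀ {y} → Context v x y → y ∈ ys)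
    context-values v x = go (Wire-noetherian v)
      where
      go : ∀ {v} → Acc (flip Wire) v → ∃ λ ys → length ys ≤ T × (∀ {y} → Context v x y → y ∈ ys)
      go {v} (acc rec) with v Fin.≟ sink
      ... | yes refl = [] , z≤n , λ
        { (sibling w _ _ _ _ _) → contradiction w (sink-isSink _)
        ; (up w _)           → contradiction w (sink-isSink _) }
      ... | no v≢sink with p , w , unique ← treelike v v≢sink
        with Fin.any? (λ g → wire? g p ×-dec (¬? (g Fin.≟ v) ×-dec (small? g ×-dec dom? g x)))
      ...   | yes (g , wg , _ , g-small , x∈g) = values g x , g-small x , only-g
        where
        only-g : ∀ {y} → Context v x y → y ∈ values g x
        only-g (sibling w′ eq wg′ _ _ val) with refl ← unique w′
          with refl ← same-child eq wg wg′ x∈g (Value⇒dom val) = ∈-values⁺ val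
        -- The sibling `g` already puts `x` into `dom p`, which rules out any contribution from
        -- further up.
        only-g (up w′ ctx) with refl ← unique w′ = contradiction (child wg x∈g) (Context⇒∉dom ctx)
      ...   | no ¬sib with ys , ys≤T , ⊆ys ← go (rec w) = ys , ys≤T , inherited
        where
        inherited : ∀ {y} → Context v x y → y ∈ ys
        inherited (sibling w′ eq wg g≢v g-small val) with refl ← unique w′ =
          contradiction (_ , wg , g≢v , g-small , Value⇒dom val) ¬sib
        inherited (up w′ ctx) with refl ← unique w′ = ⊆ys ctx

    Candidate : Gate → Fin a → Fin b → Set
    Candidate v x y = label v ≡ x ↦ y ⊎ Context v x y

    -- The two sources exclude each other: the label of `v` supplies `x` only if `x` is in `dom v`,
    -- a context only if it is not. Hence their bounds `1` and `T` need not be added.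
    candidates : 1 ≤ T → ∀ v x → ∃ λ ys → length ys ≤ T × (∀ {y} → Candidate v x y → y ∈ ys)
    candidates 1≤T v x with dom? v x
    ... | no x∉ with ys , ys≤T , ⊆ys ← context-values v x =
      ys , ys≤T , λ { (inj₁ eq) → contradiction (input eq) x∉ ; (inj₂ ctx) → ⊆ys ctx }
    ... | yes x∈ with label v in eq
    ...   | x′ ↦ y = y ∷ [] , 1≤T , λ { (inj₁ refl) → here refl ; (inj₂ ctx) → contradiction x∈ (Context⇒∉dom ctx) }
    ...   | ∪-gate = [] , z≤n , λ { (inj₁ ()) ; (inj₂ ctx) → contradiction x∈ (Context⇒∉dom ctx) }
    ...   | ×-gate = [] , z≤n , λ { (inj₁ ()) ; (inj₂ ctx) → contradiction x∈ (Context⇒∉dom ctx) }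

    module _ (large-unique : ∀ {g g₁ g₂} → label g ≡ ×-gate → Wire g₁ g → Wire g₂ g → g₁ ≢ g₂ →
                             ¬ Small g₁ → ¬ ¬ Small g₂) where

      -- Selects the child through which the descent continues, so that only small children are left
      -- behind.
      main-child : ∀ {g} → label g ≡ ×-gate →
        ∃ λ g₀ → Wire g₀ g × (∀ {g′} → Wire g′ g → g′ ≢ g₀ → Small g′)
      main-child {g} eq with Fin.any? (λ g′ → wire? g′ g ×-dec ¬? (small? g′))
      ... | yes (g₀ , w₀ , large) = g₀ , w₀ , others
        where
        others : ∀ {g′} → Wire g′ g → g′ ≢ g₀ → Small g′
        others {g′} w g′≢g₀ with small? g′
        ... | yes small = small
        ... | no large′ = contradiction large′ (large-unique eq w₀ w (g′≢g₀ ∘ sym) large)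
      -- Without a large child any child will do, and one exists because a ×-gate is not an input
      -- gate.
      ... | no ¬large with g₀ , w₀ ← ¬input⇒child (λ e → contradiction (trans (sym eq) e) λ ()) =
        g₀ , w₀ , others
        where
        others : ∀ {g′} → Wire g′ g → g′ ≢ g₀ → Small g′
        others {g′} w _ with small? g′
        ... | yes small = small
        ... | no large′ = contradiction (g′ , w , large′) ¬large

      -- The descent takes the child providing `f` at a ∪-gate and the main child at a ×-gate.
      -- Values from the other children belong to the context of `g₀`, which `Context-path` carries
      -- down to `v`.
      covered : ∀ {g f} → f Unary.∈ S g →
        ∃ λ v → Star Wire v g × (∀ {x y} → f x ≡ just y → Candidate v x y)
      covered {g} {f} (input eq f⇔) = g , ε , λ fx → inj₁ (cand fx)
        where
        cand : ∀ {x y} → f x ≡ just y → label g ≡ x ↦ y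
        cand fx with refl , refl ← Equivalence.to (f⇔ _ _) fx = eq
      covered (union _ w s) with v , path , cand ← covered s = v , path ◅◅ w ◅ ε , cand
      covered {g} {f} (times eq h hs f⇔) with g₀ , w₀ , others ← main-child eq
        with v , path , cand ← covered (hs w₀) = v , path ◅◅ w₀ ◅ ε , cand′
        where
        cand′ : ∀ {x y} → f x ≡ just y → Candidate v x y
        cand′ fx with g′ , w , hx ← Equivalence.to (f⇔ _ _) fx with g′ Fin.≟ g₀
        ... | yes refl  = cand hx
        ... | no g′≢g₀ = inj₂ (Context-path path
                (sibling w₀ eq w g′≢g₀ (others w g′≢g₀) (S⇒Value (hs w) hx)))

      -- By `covered`, each map is a tuple of candidates at one of the gates, and a single gate
      -- admits at most `T ^ a` such tuples.
      count-total-maps : 1 ≤ T → ∀ {hs : List (Vec (Fin b) a)} → Unique hs →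
        (∀ {h} → h ∈ hs → just ∘ lookup h Unary.∈ S sink) → length hs ≤ gates * T ^ a
      count-total-maps 1≤T {hs} uhs hs∈S = begin
        length hs
          ≤⟨ Unique-⊆⇒length≤ uhs hs⊆ ⟩
        length (concatMap options (allFin gates))
          ≤⟨ length-concatMap-≤ options (λ v → length-tuples-≤ _ (proj₁ ∘ proj₂ ∘ candidates 1≤T v)) (allFin gates) ⟩
        length (allFin gates) * T ^ a
          ≡⟨ cong (_* T ^ a) (length-tabulate {n = gates} id) ⟩
        gates * T ^ a ∎
        where
        open ≤-Reasoning
        options : Gate → List (Vec (Fin b) a)
        options v = tuples (proj₁ ∘ candidates 1≤T v)
        hs⊆ : ∀ {h} → h ∈ hs → h ∈ concatMap options (allFin gates)
        hs⊆ h∈ with v , _ , cand ← covered (hs∈S h∈) = ∈-concatMap⁺ options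
          (Any.map (λ { refl → ∈-tuples⁺ (λ x → proj₂ (proj₂ (candidates 1≤T v x)) (cand refl)) }) (∈-allFin v))

-- Clique counts in biclique-free graphs.

BicliqueFree : ℕ → SimpleGraph → Set
BicliqueFree T 𝒢 = ∀ {xs ys : List (Vertex 𝒢)} → Unique xs → Unique ys → T ℕ.< length xs → T ℕ.< length ys →
                   ¬ (∀ {x y} → x ∈ xs → y ∈ ys → Edge 𝒢 x y)

-- Two large children of one ×-gate would have value lists longer than `T` with all edges between
-- them, contradicting `BicliqueFree`.
count-homs : ∀ {k T 𝒢} → 1 ≤ T → BicliqueFree T 𝒢 →
  (C : Circuit (Vertex (𝒦 k)) (Vertex 𝒢)) → IsFRepresentation (𝒦 k) 𝒢 C →
  ∀ {hs} → Unique hs → (∀ {h} → h ∈ hs → lookup h Unary.∈ Hom (𝒦 k) 𝒢) →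
  length hs ≤ Circuit.gates C * T ^ k
count-homs {k} {T} {𝒢} 1≤T biclique-free C isF uhs hs∈Hom =
  count-total-maps T large-unique 1≤T uhs (λ h∈ → proj₂ represents (_ , hs∈Hom h∈ , λ _ → refl))
  where
  open IsFRepresentation isF
  open IsDRepresentation isDRepresentation
  open Circuit C
  open TreelikeCircuit C wellDefined treelike

  large : ∀ {g} → ¬ Small T g → ∃ λ x → T ℕ.< length (values g x)
  large {g} ¬small with x , >T ← Fin.¬∀⟶∃¬ _ _ (λ x → length (values g x) ≤? T) ¬small = x , ≰⇒> >T

  large-unique : ∀ {g g₁ g₂} → label g ≡ ×-gate → Wire g₁ g → Wire g₂ g → g₁ ≢ g₂ →
                 ¬ Small T g₁ → ¬ ¬ Small T g₂
  large-unique {g} {g₁} {g₂} eq w₁ w₂ g₁≢g₂ large₁ large₂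
    with x₁ , >T₁ ← large large₁ | x₂ , >T₂ ← large large₂ =
    biclique-free (unique-values g₁ x₁) (unique-values g₂ x₂) >T₁ >T₂ (λ y₁∈ y₂∈ → adjacent (∈-values⁻ y₁∈) (∈-values⁻ y₂∈))
    where
    unique-values : ∀ g x → Unique (values g x)
    unique-values g x = Unique.filter⁺ (value? g x) (Unique.allFin⁺ _)
    adjacent : ∀ {y₁ y₂} → Value g₁ x₁ y₁ → Value g₂ x₂ y₂ → Edge 𝒢 y₁ y₂
    adjacent v₁ v₂
      with F , F∈S , Fx₁ , Fx₂ ← values-jointly-attained eq w₁ w₂ g₁≢g₂ v₁ v₂
      with h , h∈Hom , F≗h ← proj₁ represents F∈S =
      subst₂ (Edge 𝒢) (just-injective (trans (sym (F≗h x₁)) Fx₁)) (just-injective (trans (sym (F≗h x₂)) Fx₂))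
        -- The arguments `x₁` and `x₂` lie in disjoint domains, so they are distinct and thus
        -- adjacent in `𝒦 k`.
        (h∈Hom λ { refl → ×-dom′ (Value⇒dom v₁ , Value⇒dom v₂) })
      where
      ×-dom′ = Circuit.WellDefined.×-dom wellDefined eq w₁ w₂ g₁≢g₂

-- The graph

countedEdge? : (𝒢 : SimpleGraph) → Unary.Decidable (λ ((u , v) : Vertex 𝒢 × Vertex 𝒢) → u Fin.< v × Edge 𝒢 u v)
countedEdge? 𝒢 (u , v) = (u Fin.<? v) ×-dec SimpleGraph.edge? 𝒢 u v

edgeCount≤order² : ∀ 𝒢 → edgeCount 𝒢 ≤ SimpleGraph.order 𝒢 * SimpleGraph.order 𝒢
edgeCount≤order² 𝒢 = begin
  edgeCount 𝒢                           ≤⟨ length-filter (countedEdge? 𝒢) (pairs N) ⟩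
  length (pairs N)                      ≡⟨ length-cartesianProductWith _,_ (allFin N) (allFin N) ⟩
  length (allFin N) * length (allFin N) ≡⟨ cong₂ _*_ (length-tabulate {n = N} id) (length-tabulate {n = N} id) ⟩
  N * N                                 ∎
  where
  open ≤-Reasoning
  N = SimpleGraph.order 𝒢

module MultipartiteGraph {k n} (φ : Fin n → Fin n → Bool) (s : Fin k → Fin k → Bool) where

  -- Since `φ` need not be symmetric, colours are read with the lower-indexed part first; symmetry
  -- is then a swap of the disjuncts.
  Adjacent : Fin k × Fin n → Fin k × Fin n → Set
  Adjacent (i , x) (j , y) = (i Fin.< j × φ x y ≡ s i j) ⊎ (j Fin.< i × φ y x ≡ s j i)

  adjacent? : ∀ u v → Dec (Adjacent u v)
  adjacent? (i , x) (j , y) =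
    ((i Fin.<? j) ×-dec (φ x y Bool.≟ s i j)) ⊎-dec ((j Fin.<? i) ×-dec (φ y x Bool.≟ s j i))

  adjacent-irrefl : ∀ u → ¬ Adjacent u u
  adjacent-irrefl _ (inj₁ (i<i , _)) = Fin.<-irrefl refl i<i
  adjacent-irrefl _ (inj₂ (i<i , _)) = Fin.<-irrefl refl i<i

  Edgeᵒ : (u v : Fin (suc (k * n))) → Set
  Edgeᵒ Fin.zero    Fin.zero    = ⊥
  Edgeᵒ Fin.zero    (Fin.suc v) = ⊤
  Edgeᵒ (Fin.suc u) Fin.zero    = ⊤
  Edgeᵒ (Fin.suc u) (Fin.suc v) = Adjacent (remQuot n u) (remQuot n v)

  -- The apex Fin.zero is there only to guarantee k * n edges, so that log n ≤ log m.
  graph : SimpleGraph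
  graph = record
    { order  = suc (k * n)
    ; Edge   = Edgeᵒ
    ; edge?  = edge?
    ; sym    = λ {u} {v} → edge-sym u v
    ; irrefl = λ { {u} refl → edge-irrefl u }
    }
    where
    edge? : ∀ u v → Dec (Edgeᵒ u v)
    edge? Fin.zero    Fin.zero    = no λ ()
    edge? Fin.zero    (Fin.suc v) = yes tt
    edge? (Fin.suc u) Fin.zero    = yes tt
    edge? (Fin.suc u) (Fin.suc v) = adjacent? (remQuot n u) (remQuot n v)
    edge-sym : ∀ u v → Edgeᵒ u v → Edgeᵒ v u
    edge-sym Fin.zero    (Fin.suc v) _ = tt
    edge-sym (Fin.suc u) Fin.zero    _ = tt
    edge-sym (Fin.suc u) (Fin.suc v) e = swap e
    edge-irrefl : ∀ u → ¬ Edgeᵒ u u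
    edge-irrefl Fin.zero    ()
    edge-irrefl (Fin.suc u) e = adjacent-irrefl (remQuot n u) e

  vertex : Fin k → Fin n → Fin (suc (k * n))
  vertex i x = Fin.suc (combine i x)

  edge⇒adjacent : ∀ {i x j y} → Edgeᵒ (vertex i x) (vertex j y) → Adjacent (i , x) (j , y)
  edge⇒adjacent {i} {x} {j} {y} = subst₂ Adjacent (Fin.remQuot-combine i x) (Fin.remQuot-combine j y)

  adjacent⇒edge : ∀ {i x j y} → Adjacent (i , x) (j , y) → Edgeᵒ (vertex i x) (vertex j y)
  adjacent⇒edge {i} {x} {j} {y} = subst₂ Adjacent (sym (Fin.remQuot-combine i x)) (sym (Fin.remQuot-combine j y))

  -- The edges at the apex suffice; the apex is the least vertex, so each is counted as a pair
  -- starting with it.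
  k*n≤edgeCount : k * n ≤ edgeCount graph
  k*n≤edgeCount = begin
    k * n                                ≡⟨ sym (length-tabulate {n = k * n} id) ⟩
    length (allFin (k * n))              ≡⟨ sym (length-map _ (allFin (k * n))) ⟩
    length (map apexEdge (allFin (k * n))) ≤⟨ Unique-⊆⇒length≤ (Unique.map⁺ apexEdge-injective (Unique.allFin⁺ (k * n))) edges ⟩
    edgeCount graph                      ∎
    where
    open ≤-Reasoning
    apexEdge : Fin (k * n) → Fin (suc (k * n)) × Fin (suc (k * n))
    apexEdge v = Fin.zero , Fin.suc v
    apexEdge-injective : ∀ {u v} → apexEdge u ≡ apexEdge v → u ≡ v
    apexEdge-injective refl = refl
    edges : ∀ {e} → e ∈ map apexEdge (allFin (k * n)) → e ∈ filter (countedEdge? graph) (pairs (suc (k * n)))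
    edges e∈ with v , _ , refl ← ∈-map⁻ apexEdge e∈ =
      ∈-filter⁺ (countedEdge? graph) (∈-cartesianProduct⁺ (∈-allFin _) (∈-allFin _)) (s≤s z≤n , tt)

  part : List (Fin (suc (k * n))) → Fin k → List (Fin n)
  part us i = filter (λ x → vertex i x ∈? us) (allFin n)
    where open DecMembership (Fin._≟_ {suc (k * n)}) using (_∈?_)

  ∈-part⁻ : ∀ {us i x} → x ∈ part us i → vertex i x ∈ us
  ∈-part⁻ {us} {i} = proj₂ ∘ ∈-filter⁻ _ {xs = allFin n}

  Unique-part : ∀ us i → Unique (part us i)
  Unique-part us i = Unique.filter⁺ _ (Unique.allFin⁺ n)

  -- Pigeonhole over the `k` parts; the extra `1` in the bound is for the apex, which lies in no
  -- part.
  large-part : ∀ t {us} → Unique us → suc (k * t) ℕ.< length us → ∃ λ i → t ℕ.< length (part us i)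
  large-part t {us} uus us> with Fin.any? (λ i → suc t ≤? length (part us i))
  ... | yes large = large
  ... | no ¬large = contradiction us> (≤⇒≯ (begin
    length us
      ≤⟨ Unique-⊆⇒length≤ uus us⊆ ⟩
    suc (length (concatMap slice (allFin k)))
      ≤⟨ s≤s (length-concatMap-≤ slice slice≤ (allFin k)) ⟩
    suc (length (allFin k) * t)
      ≡⟨ cong (λ l → suc (l * t)) (length-tabulate {n = k} id) ⟩
    suc (k * t) ∎))
    where
    open ≤-Reasoning
    slice : Fin k → List (Fin (suc (k * n)))
    slice i = map (vertex i) (part us i)
    slice≤ : ∀ i → length (slice i) ≤ t
    slice≤ i = ≤-trans (≤-reflexive (length-map _ (part us i))) (≮⇒≥ (λ t< → ¬large (i , t<)))
    us⊆ : ∀ {u} → u ∈ us → u ∈ Fin.zero ∷ concatMap slice (allFin k)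
    us⊆ {Fin.zero}  _   = here refl
    us⊆ {Fin.suc u} u∈ with i , x , refl ← Fin.combine-surjective {k} {n} u = there (∈-concatMap⁺ slice
      (Any.map (λ { refl → ∈-map⁺ (vertex i) (∈-filter⁺ _ (∈-allFin x) u∈) }) (∈-allFin i)))

  -- Each side has more than `t` vertices in some part. The edges between two such sets in different
  -- parts all carry the colour that `s` prescribes for these parts, so they form a monochromatic
  -- rectangle of `φ`.
  biclique-free : ∀ {t} →
    (∀ c {xs ys} → Unique xs → Unique ys → t ℕ.< length xs → t ℕ.< length ys →
      ¬ (∀ {x y} → x ∈ xs → y ∈ ys → φ x y ≡ c)) →
    BicliqueFree (suc (k * t)) graph
  biclique-free {t} no-mono {us} {vs} uus uvs us> vs> complete
    with i , >tᵢ ← large-part t uus us> | j , >tⱼ ← large-part t uvs vs> with Fin.<-cmp i j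
  ... | tri< i<j _ _ = no-mono (s i j) (Unique-part us i) (Unique-part vs j) >tᵢ >tⱼ mono
    where
    mono : ∀ {x y} → x ∈ part us i → y ∈ part vs j → φ x y ≡ s i j
    mono x∈ y∈ with edge⇒adjacent (complete (∈-part⁻ x∈) (∈-part⁻ y∈))
    ... | inj₁ (_ , eq)  = eq
    ... | inj₂ (j<i , _) = contradiction j<i (Fin.<-asym i<j)
  ... | tri> _ _ j<i = no-mono (s j i) (Unique-part vs j) (Unique-part us i) >tⱼ >tᵢ mono
    where
    mono : ∀ {x y} → x ∈ part vs j → y ∈ part us i → φ x y ≡ s j i
    mono x∈ y∈ with edge⇒adjacent (complete (∈-part⁻ y∈) (∈-part⁻ x∈))
    ... | inj₁ (i<j , _) = contradiction i<j (Fin.<-asym j<i)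
    ... | inj₂ (_ , eq)  = eq
  -- Vertices of one part are never adjacent, so `mono` holds by absurdity and the colour `s i i` is
  -- an arbitrary choice.
  ... | tri≈ _ refl _ = no-mono (s i i) (Unique-part us i) (Unique-part vs i) >tᵢ >tⱼ mono
    where
    mono : ∀ {x y} → x ∈ part us i → y ∈ part vs i → φ x y ≡ s i i
    mono x∈ y∈ with edge⇒adjacent (complete (∈-part⁻ x∈) (∈-part⁻ y∈))
    ... | inj₁ (i<i , _) = contradiction i<i (Fin.<-irrefl refl)
    ... | inj₂ (i<i , _) = contradiction i<i (Fin.<-irrefl refl)

  transversal : Vec (Fin n) k → Vec (Fin (suc (k * n))) k
  transversal x = Vec.tabulate (λ i → vertex i (lookup x i))

  lookup-transversal : ∀ x i → lookup (transversal x) i ≡ vertex i (lookup x i)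
  lookup-transversal x = Vec.lookup∘tabulate (λ i → vertex i (lookup x i))

  transversal-injective : ∀ {x y} → transversal x ≡ transversal y → x ≡ y
  transversal-injective {x} {y} eq = begin
    x                         ≡⟨ sym (Vec.tabulate∘lookup x) ⟩
    Vec.tabulate (lookup x)   ≡⟨ Vec.tabulate-cong pointwise ⟩
    Vec.tabulate (lookup y)   ≡⟨ Vec.tabulate∘lookup y ⟩
    y                         ∎
    where
    open ≡-Reasoning
    pointwise : ∀ i → lookup x i ≡ lookup y i
    pointwise i = Fin.combine-injectiveʳ i (lookup x i) i (lookup y i) (Fin.suc-injective
      (trans (sym (lookup-transversal x i)) (trans (cong (λ v → lookup v i) eq) (lookup-transversal y i))))

  transversal∈Hom : ∀ {x} → (∀ i j → φ (lookup x i) (lookup x j) ≡ s i j) →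
                    lookup (transversal x) Unary.∈ Hom (𝒦 k) graph
  transversal∈Hom {x} profile {i} {j} i≢j =
    subst₂ Edgeᵒ (sym (lookup-transversal x i)) (sym (lookup-transversal x j)) (adjacent⇒edge adjacent)
    where
    adjacent : Adjacent (i , lookup x i) (j , lookup x j)
    adjacent with Fin.<-cmp i j
    ... | tri< i<j _ _ = inj₁ (i<j , profile i j)
    ... | tri≈ _ i≡j _ = contradiction i≡j i≢j
    ... | tri> _ _ j<i = inj₂ (j<i , profile j i)

-- Pigeonhole over the `2 ^ (k * k)` profiles, coded as numbers for `largest-fibre`. Recording all
-- ordered pairs instead of those with `i < j` costs only a factor depending on `k`.
popular-profile : ∀ {n} k (φ : Fin n → Fin n → Bool) →
  Σ (Fin k → Fin k → Bool) λ s → ∃ λ xs → Unique xs × n ^ k ≤ 2 ^ (k * k) * length xs ×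
  (∀ {x : Vec (Fin n) k} → x ∈ xs → ∀ i j → φ (lookup x i) (lookup x j) ≡ s i j)
popular-profile {n} k φ = s , fibre profile all code , Unique-fibre profile code unique-all , enough , same-profile
  where
  open ≡-Reasoning
  open Inverse Fin.2↔Bool using () renaming (to to bool; from to bit; strictlyInverseˡ to bool-bit)
  all = tuples {k = k} (λ _ → allFin n)
  unique-all : Unique all
  unique-all = Unique-tuples (λ _ → Unique.allFin⁺ n)
  bits : Vec (Fin n) k → Fin k × Fin k → Fin 2
  bits x (i , j) = bit (φ (lookup x i) (lookup x j))
  profile : Vec (Fin n) k → Fin (2 ^ (k * k))
  profile x = funToFin (bits x ∘ remQuot k)
  popular = largest-fibre {{m^n≢0 2 (k * k)}} profile unique-all
  code = proj₁ popular
  s : Fin k → Fin k → Bool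
  s i j = bool (finToFun code (combine i j))
  enough : n ^ k ≤ 2 ^ (k * k) * length (fibre profile all code)
  enough = subst (_≤ 2 ^ (k * k) * length (fibre profile all code))
    (trans (length-tuples k (allFin n)) (cong (_^ k) (length-tabulate {n = n} id))) (proj₂ popular)
  same-profile : ∀ {x} → x ∈ fibre profile all code → ∀ i j → φ (lookup x i) (lookup x j) ≡ s i j
  same-profile {x} x∈ i j = begin
    φ (lookup x i) (lookup x j)                 ≡⟨ sym (bool-bit _) ⟩
    bool (bits x (i , j))                       ≡⟨ cong (bool ∘ bits x) (sym (Fin.remQuot-combine i j)) ⟩
    bool (bits x (remQuot k (combine i j)))     ≡⟨ cong bool (sym (Fin.finToFun-funToFin (bits x ∘ remQuot k) (combine i j))) ⟩
    bool (finToFun (profile x) (combine i j))   ≡⟨ cong (λ c → bool (finToFun c (combine i j))) (proj₂ (∈-fibre⁻ profile all x∈)) ⟩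
    s i j                                       ∎

-- Abstract because unfolding edgeCount of this graph is infeasible.
abstract

  clique-rich-graph : ∀ k r → let n = 2 ^ r in
    Σ SimpleGraph λ 𝒢 → k * n ≤ edgeCount 𝒢 × edgeCount 𝒢 ≤ suc (k * n) * suc (k * n) ×
    BicliqueFree (suc (k * suc (2 * r))) 𝒢 ×
    ∃ λ hs → Unique hs × n ^ k ≤ 2 ^ (k * k) * length hs × (∀ {h} → h ∈ hs → lookup h Unary.∈ Hom (𝒦 k) 𝒢)
  clique-rich-graph k r
    with φ , no-mono ← balanced-colouring r
    with s , xs , uxs , enough , same-profile ← popular-profile k φ =
    -- Here `t` is `suc (2 * r)`, so that `t < l` is `side r ≤ l` by computation.
    graph , k*n≤edgeCount , edgeCount≤order² graph , biclique-free no-mono ,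
    map transversal xs , Unique.map⁺ transversal-injective uxs ,
    subst (λ l → (2 ^ r) ^ k ≤ 2 ^ (k * k) * l) (sym (length-map transversal xs)) enough ,
    λ h∈ → homs (∈-map⁻ transversal h∈)
    where
    open MultipartiteGraph φ s
    homs : ∀ {h} → ∃ (λ x → x ∈ xs × h ≡ transversal x) → lookup h Unary.∈ Hom (𝒦 k) graph
    homs (x , x∈ , refl) = transversal∈Hom {x} (same-profile x∈)

-- From the number of cliques to the bound in terms of edges.

scale : ℕ → ℕ
scale k = suc k ^ k * 2 ^ (k * k) * (4 * k) ^ k

^-distribʳ-* : ∀ o m n → (m * n) ^ o ≡ m ^ o * n ^ o
^-distribʳ-* zero    m n = refl
^-distribʳ-* (suc o) m n = trans (cong (m * n *_) (^-distribʳ-* o m n)) ([m*n]*[o*p]≡[m*o]*[n*p] m n (m ^ o) (n ^ o))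

2^-cancel-≤ : ∀ {m n} → 2 ^ m ≤ 2 ^ n → m ≤ n
2^-cancel-≤ {m} {n} 2^m≤2^n = ≮⇒≥ λ n<m → ≤⇒≯ 2^m≤2^n (^-monoʳ-< 2 (s≤s (s≤s z≤n)) n<m)

-- Since `n ≤ m`, the exponent `r = log n` is at most `p / q`, which bounds the biclique size by
-- `4 * k * p / q`. In `scale k`, the factor `suc k ^ k` comes from `m ≤ (suc k * n) ^ 2`,
-- `2 ^ (k * k)` from the number of profiles and `(4 * k) ^ k` from the biclique size.
size-bound : ∀ {k r m G p q} → 1 ≤ k → 1 ≤ r → let n = 2 ^ r in
  k * n ≤ m → m ≤ suc (k * n) * suc (k * n) →
  n ^ k ≤ 2 ^ (k * k) * (G * suc (k * suc (2 * r)) ^ k) →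
  m ^ q ≤ 2 ^ p →
  m ^ k * q ^ (2 * k) ≤ (scale k ^ 2 * G ^ 2) * p ^ (2 * k)
size-bound {k} {r} {m} {G} {p} {q} 1≤k 1≤r kn≤m m≤ nᵏ≤ m^q≤2^p = begin
  m ^ k * q ^ (2 * k)                     ≤⟨ *-monoˡ-≤ (q ^ (2 * k)) (^-monoˡ-≤ k m≤sq) ⟩
  ((A * n) ^ 2) ^ k * q ^ (2 * k)         ≡⟨ cong₂ _*_ (^-swap (A * n)) (^-2* q) ⟩
  ((A * n) ^ k) ^ 2 * (q ^ k) ^ 2         ≡⟨ sym (^-distribʳ-* 2 ((A * n) ^ k) (q ^ k)) ⟩
  ((A * n) ^ k * q ^ k) ^ 2               ≤⟨ ^-monoˡ-≤ 2 root ⟩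
  (scale k * G * p ^ k) ^ 2               ≡⟨ ^-distribʳ-* 2 (scale k * G) (p ^ k) ⟩
  (scale k * G) ^ 2 * (p ^ k) ^ 2         ≡⟨ cong₂ _*_ (^-distribʳ-* 2 (scale k) G) (sym (^-2* p)) ⟩
  (scale k ^ 2 * G ^ 2) * p ^ (2 * k)     ∎
  where
  open ≤-Reasoning
  n = 2 ^ r
  A = suc k
  T = suc (k * suc (2 * r))
  1≤n : 1 ≤ n
  1≤n = m^n>0 2 r

  ^-2* : ∀ x → x ^ (2 * k) ≡ (x ^ k) ^ 2
  ^-2* x = trans (cong (x ^_) (*-comm 2 k)) (sym (^-*-assoc x k 2))
  ^-swap : ∀ x → (x ^ 2) ^ k ≡ (x ^ k) ^ 2
  ^-swap x = trans (^-*-assoc x 2 k) (^-2* x)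

  m≤sq : m ≤ (A * n) ^ 2
  m≤sq = begin
    m                             ≤⟨ m≤ ⟩
    suc (k * n) * suc (k * n)     ≤⟨ *-mono-≤ (+-monoˡ-≤ (k * n) 1≤n) (+-monoˡ-≤ (k * n) 1≤n) ⟩
    (A * n) * (A * n)             ≡⟨ cong ((A * n) *_) (sym (*-identityʳ (A * n))) ⟩
    (A * n) ^ 2                   ∎

  rq≤p : r * q ≤ p
  rq≤p = 2^-cancel-≤ (begin
    2 ^ (r * q) ≡⟨ sym (^-*-assoc 2 r q) ⟩
    n ^ q       ≤⟨ ^-monoˡ-≤ q (≤-trans (≤-trans (≤-reflexive (sym (*-identityˡ n))) (*-monoˡ-≤ n 1≤k)) kn≤m) ⟩
    m ^ q       ≤⟨ m^q≤2^p ⟩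
    2 ^ p       ∎)

  T≤ : T ≤ 4 * k * r
  T≤ = begin
    1 + k * suc (2 * r)             ≡⟨ cong suc (*-suc k (2 * r)) ⟩
    1 + (k + k * (2 * r))           ≤⟨ +-mono-≤ (*-mono-≤ 1≤k 1≤r) (+-monoˡ-≤ (k * (2 * r)) k≤kr) ⟩
    k * r + (k * r + k * (2 * r))   ≡⟨ solve 2 (λ k r → k :* r :+ (k :* r :+ k :* (con 2 :* r)) := con 4 :* k :* r) refl k r ⟩
    4 * k * r                       ∎
    where
    k≤kr : k ≤ k * r
    k≤kr = ≤-trans (≤-reflexive (sym (*-identityʳ k))) (*-monoʳ-≤ k 1≤r)

  Tq≤ : T * q ≤ 4 * k * p
  Tq≤ = begin
    T * q           ≤⟨ *-monoˡ-≤ q T≤ ⟩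
    4 * k * r * q   ≡⟨ *-assoc (4 * k) r q ⟩
    4 * k * (r * q) ≤⟨ *-monoʳ-≤ (4 * k) rq≤p ⟩
    4 * k * p       ∎

  -- The desired inequality before squaring.
  root : (A * n) ^ k * q ^ k ≤ scale k * G * p ^ k
  root = begin
    (A * n) ^ k * q ^ k
      ≡⟨ cong (_* q ^ k) (^-distribʳ-* k A n) ⟩
    A ^ k * n ^ k * q ^ k
      ≤⟨ *-monoˡ-≤ (q ^ k) (*-monoʳ-≤ (A ^ k) nᵏ≤) ⟩
    A ^ k * (2 ^ (k * k) * (G * T ^ k)) * q ^ k
      ≡⟨ solve 5 (λ a b g t q → a :* (b :* (g :* t)) :* q := a :* b :* g :* (t :* q)) refl (A ^ k) (2 ^ (k * k)) G (T ^ k) (q ^ k) ⟩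
    A ^ k * 2 ^ (k * k) * G * (T ^ k * q ^ k)
      ≡⟨ cong (A ^ k * 2 ^ (k * k) * G *_) (sym (^-distribʳ-* k T q)) ⟩
    A ^ k * 2 ^ (k * k) * G * (T * q) ^ k
      ≤⟨ *-monoʳ-≤ (A ^ k * 2 ^ (k * k) * G) (^-monoˡ-≤ k Tq≤) ⟩
    A ^ k * 2 ^ (k * k) * G * (4 * k * p) ^ k
      ≡⟨ cong (A ^ k * 2 ^ (k * k) * G *_) (^-distribʳ-* k (4 * k) p) ⟩
    A ^ k * 2 ^ (k * k) * G * ((4 * k) ^ k * p ^ k)
      ≡⟨ solve 5 (λ a b g c p → a :* b :* g :* (c :* p) := a :* b :* c :* g :* p) refl (A ^ k) (2 ^ (k * k)) G ((4 * k) ^ k) (p ^ k) ⟩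
    scale k * G * p ^ k ∎

n<2^n : ∀ n → n ℕ.< 2 ^ n
n<2^n zero    = s≤s z≤n
n<2^n (suc n) = begin
  2 + n             ≤⟨ s≤s (n<2^n n) ⟩
  1 + 2 ^ n         ≤⟨ +-mono-≤ (m^n>0 2 n) (≤-reflexive (sym (+-identityʳ (2 ^ n)))) ⟩
  2 * 2 ^ n         ∎
  where open ≤-Reasoning

-- Built with `mkℚ` so that the numerator `1` and the denominator `suc d` in `AtLeast` appear by
-- computation.
1/1+ : ℕ → ℚ
1/1+ d = mkℚ 1ℤ d (1-coprimeTo (suc d))

0<1/1+ : ∀ d → 0ℚ < 1/1+ d
0<1/1+ d = *<* (+<+ (s≤s z≤n))

theorem5p1 : (k : ℕ) →
    Σ ℚ λ c → (0ℚ < c) ×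
    ((M : ℕ) →
    Σ SimpleGraph λ 𝒢 → (M ≤ edgeCount 𝒢) × Satisfiable (Hom (𝒦 k) 𝒢) ×
    ((C : Circuit (Vertex (𝒦 k)) (Vertex 𝒢)) → IsFRepresentation (𝒦 k) 𝒢 C →
    AtLeast (size C) c (edgeCount 𝒢) k))
-- For `k = 0` the bound is the constant 1, met because the sink is a gate. The graph is taken for
-- one part, since with no parts only the apex would remain and there would be no edges.
theorem5p1 zero = 1/1+ 0 , 0<1/1+ 0 , λ M →
  let 𝒢 , 1*n≤m , _ = clique-rich-graph 1 M
  in 𝒢 , ≤-trans (<⇒≤ (n<2^n M)) (≤-trans (m≤m+n _ 0) 1*n≤m) , ((λ ()) , λ {i} → ⊥-elim (Fin.¬Fin0 i)) , λ C _ p q _ →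
    *-mono-≤ (*-mono-≤ {1} ≤-refl (^-monoˡ-≤ 2 (1≤size C))) ≤-refl
  where
  1≤size : ∀ {A B} (C : Circuit A B) → 1 ≤ size C
  1≤size C = ≤-trans (≤-trans (s≤s z≤n) (Fin.toℕ<n (Circuit.sink C))) (m≤m+n _ _)
theorem5p1 k@(suc k-1) = 1/1+ (scale k) , 0<1/1+ (scale k) , construction
  where
  construction : (M : ℕ) → Σ SimpleGraph λ 𝒢 → (M ≤ edgeCount 𝒢) × Satisfiable (Hom (𝒦 k) 𝒢) ×
    ((C : Circuit (Vertex (𝒦 k)) (Vertex 𝒢)) → IsFRepresentation (𝒦 k) 𝒢 C →
    AtLeast (size C) (1/1+ (scale k)) (edgeCount 𝒢) k)
  construction M with 𝒢 , kn≤m , m≤ , biclique-free , hs , uhs , enough , hs∈Hom ← clique-rich-graph k (suc M) =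
    𝒢 , M≤m , satisfiable hs enough hs∈Hom , bound
    where
    -- Positive, as `size-bound` requires, and large enough that `2 ^ r` exceeds `M`.
    r = suc M
    T = suc (k * suc (2 * r))

    M≤m : M ≤ edgeCount 𝒢
    M≤m = ≤-trans (≤-trans (<⇒≤ (<-trans (n<1+n M) (n<2^n r))) (m≤n*m (2 ^ r) k)) kn≤m

    satisfiable : ∀ hs → (2 ^ r) ^ k ≤ 2 ^ (k * k) * length hs →
                  (∀ {h} → h ∈ hs → lookup h Unary.∈ Hom (𝒦 k) 𝒢) → Satisfiable (Hom (𝒦 k) 𝒢)
    satisfiable (h ∷ _) _ homs = lookup h , homs (here refl)
    satisfiable []      n^k≤ _ = contradiction
      (≤-trans (m^n>0 (2 ^ r) {{m^n≢0 2 r}} k) (≤-trans n^k≤ (≤-reflexive (*-zeroʳ (2 ^ (k * k)))))) λ ()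

    bound : (C : Circuit (Vertex (𝒦 k)) (Vertex 𝒢)) → IsFRepresentation (𝒦 k) 𝒢 C →
            AtLeast (size C) (1/1+ (scale k)) (edgeCount 𝒢) k
    bound C isF p q m^q≤2^p = begin
      (1 * edgeCount 𝒢 ^ k) * q ^ (2 * k)             ≡⟨ cong (_* q ^ (2 * k)) (*-identityˡ (edgeCount 𝒢 ^ k)) ⟩
      edgeCount 𝒢 ^ k * q ^ (2 * k)                   ≤⟨ size-bound {k} {r} {G = size C} {p} {q} (s≤s z≤n) (s≤s z≤n) kn≤m m≤ nᵏ≤ m^q≤2^p ⟩
      (scale k ^ 2 * size C ^ 2) * p ^ (2 * k)        ≤⟨ *-monoˡ-≤ (p ^ (2 * k)) (*-monoˡ-≤ (size C ^ 2) (^-monoˡ-≤ 2 (n≤1+n (scale k)))) ⟩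
      (suc (scale k) ^ 2 * size C ^ 2) * p ^ (2 * k)  ∎
      where
      open ≤-Reasoning
      nᵏ≤ : (2 ^ r) ^ k ≤ 2 ^ (k * k) * (size C * T ^ k)
      nᵏ≤ = begin
        (2 ^ r) ^ k                              ≤⟨ enough ⟩
        2 ^ (k * k) * length hs                  ≤⟨ *-monoʳ-≤ (2 ^ (k * k)) (count-homs (s≤s z≤n) biclique-free C isF uhs hs∈Hom) ⟩
        2 ^ (k * k) * (Circuit.gates C * T ^ k)  ≤⟨ *-monoʳ-≤ (2 ^ (k * k)) (*-monoˡ-≤ (T ^ k) (m≤m+n (Circuit.gates C) _)) ⟩
        2 ^ (k * k) * (size C * T ^ k)           ∎
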